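{- The number \[ \theta:=\sum_{n=1}^{\infty}\frac{1}{2^{n!}}=\frac12+\frac14+\frac1{64}+\cdots \] is a Liouville number (and thus irrational), and for each $\sigma\in\{\leq,<\}$ and every $n\geq 1$ there is a unique maximizing $n$-term denominator tuple for $R_n^{\sigma}(\theta)$, namely the $n$-term greedy denominator tuple of $\theta$.
   Context: $\mathbb{N}=\{1,2,\ldots\}$. For $n\geq 1$ let $\mathcal{E}_n^{\leq}=\{(a_1,\ldots,a_n)\in\mathbb{N}^n: 2\leq a_1\leq\cdots\leq a_n\}$ and $\mathcal{E}_n^{<}=\{(a_1,\ldots,a_n)\in\mathbb{N}^n: 2\leq a_1<\cdots<a_n\}$. For a real $\mu>0$ and $\sigma\in\{\leq,<\}$ define \[ R_n^{\sigma}(\mu)=\max\Bigl\{\sum_{i=1}^n\frac1{a_i}:\ (a_1,\ldots,a_n)\in\mathcal{E}_n^{\sigma},\ \sum_{i=1}^n\frac1{a_i}<\mu\Bigr\} \] (the maximum is known to exist). A tuple in $\mathcal{E}_n^{\sigma}$ attaining this maximum is called a maximizing $n$-term denominator tuple for $R_n^\sigma(\mu)$. Greedy algorithm: the greedy denominators $g_1,g_2,\ldots$ of $\mu>0$ under the convention $\sigma$ are defined recursively: $g_1$ is the smallest integer $x\geq 2$ with $1/x<\mu$, and $g_{i+1}$ is the smallest integer $x\geq 2$ with $x\geq g_i$ (if $\sigma$ is $\leq$), respectively $x>g_i$ (if $\sigma$ is $<$), for which $1/x<\mu-\sum_{j=1}^{i}1/g_j$. The $n$-term greedy denominator tuple is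 $(g_1,\ldots,g_n)$. A Liouville number is a real number $\theta$ such that for every positive integer $m$ there are integers $P$ and $Q\geq 2$ with $0<|\theta-P/Q|<Q^{ -m}$. -}

module Defs where

open import Data.Integer.Base as ℤ using (ℤ; +_)
import Data.Integer.Properties as ℤₚ
open import Data.Fin.Base using (Fin; toℕ)
open import Data.Nat.Base as ℕ using (ℕ; zero; suc; _!; _^_; NonZero; >-nonZero; s≤s; z≤n)
import Data.Nat.Properties as ℕₚ
import Data.Nat.Solver as ℕSolver
open import Data.Product.Base using (∃-syntax; Σ-syntax; _×_; _,_)
open import Data.Rational.Base
  using (ℚ; mkℚ; 0ℚ; ½; _/_; _+_; _-_; _*_; -_; ∣_∣; _≤_; _<_; *<*)
import Data.Rational.Base as ℚ
import Data.Rational.Properties as ℚₚ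
open import Data.Rational.Solver using (module +-*-Solver)
import Data.Rational.Unnormalised.Base as ℚᵘ
import Data.Rational.Unnormalised.Properties as ℚᵘₚ
open import Data.Sum.Base using (inj₁; inj₂)
open import Data.Unit.Base using (⊤)
open import Data.Vec.Base using (Vec; []; _∷_; tabulate)
open import Data.Vec.Relation.Unary.All using (All)
open import Data.Vec.Relation.Unary.Linked using (Linked)
open import Relation.Binary.PropositionalEquality
open import Relation.Nullary using (¬_)

------------------------------------------------------------------------
-- Real numbers, as Cauchy sequences of rationals up to _≃_

IsCauchy : (ℕ → ℚ) → Set
IsCauchy x = ∀ ε → 0ℚ < ε →
  ∃[ N ] (∀ m n → N ℕ.≤ m → N ℕ.≤ n → ∣ x m - x n ∣ < ε)

record ℝ : Set where
  constructor mkℝ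
  field
    seq    : ℕ → ℚ
    cauchy : IsCauchy seq

open ℝ public

infix 4 _≃_ _<ᵣ_
infixl 6 _-ᵣ_

-- Equality of the limits; _≡_ on ℝ would compare representatives.
_≃_ : ℝ → ℝ → Set
x ≃ y = ∀ ε → 0ℚ < ε → ∃[ N ] (∀ n → N ℕ.≤ n → ∣ seq x n - seq y n ∣ < ε)

-- The terms must eventually be separated by a fixed positive rational;
-- termwise strict inequality alone would allow equal limits.
_<ᵣ_ : ℝ → ℝ → Set
x <ᵣ y = ∃[ ε ] (0ℚ < ε × ∃[ N ] (∀ n → N ℕ.≤ n → seq x n + ε ≤ seq y n))

module ℚ-Lemmas where
  p-p≡0 : ∀ p → p - p ≡ 0ℚ
  p-p≡0 = ℚₚ.+-inverseʳ

  ½ε>0 : ∀ {ε} → 0ℚ < ε → 0ℚ < ½ * ε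
  ½ε>0 {ε} 0<ε = subst (_< ½ * ε) (ℚₚ.*-zeroʳ ½) (ℚₚ.*-monoʳ-<-pos ½ 0<ε)

  ½ε+½ε≡ε : ∀ ε → ½ * ε + ½ * ε ≡ ε
  ½ε+½ε≡ε ε = trans (sym (ℚₚ.*-distribʳ-+ ε ½ ½)) (ℚₚ.*-identityˡ ε)

  sub-sub : ∀ a b c d → (a - b) - (c - d) ≡ (a - c) - (b - d)
  sub-sub = solve 4 (λ a b c d → (a :- b) :- (c :- d) := (a :- c) :- (b :- d)) refl
    where open +-*-Solver

  neg-sub : ∀ p q → - (p - q) ≡ q - p
  neg-sub = solve 2 (λ p q → :- (p :- q) := q :- p) refl
    where open +-*-Solver

  add-sub : ∀ p q → (p - q) + q ≡ p
  add-sub = solve 2 (λ p q → (p :- q) :+ q := p) refl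
    where open +-*-Solver

  swap-sub : ∀ p q r → (p + q) - r ≡ (p - r) + q
  swap-sub = solve 3 (λ p q r → (p :+ q) :- r := (p :- r) :+ q) refl
    where open +-*-Solver

  ∣p-q∣≡∣q-p∣ : ∀ p q → ∣ p - q ∣ ≡ ∣ q - p ∣
  ∣p-q∣≡∣q-p∣ p q = trans (sym (ℚₚ.∣-p∣≡∣p∣ (p - q))) (cong ∣_∣ (neg-sub p q))

  ∣p∣-∣q∣≤∣p-q∣ : ∀ p q → ∣ p ∣ - ∣ q ∣ ≤ ∣ p - q ∣
  ∣p∣-∣q∣≤∣p-q∣ p q = begin
    ∣ p ∣ - ∣ q ∣                 ≡⟨ cong (λ r → ∣ r ∣ - ∣ q ∣) (add-sub p q) ⟨
    ∣ (p - q) + q ∣ - ∣ q ∣       ≤⟨ ℚₚ.+-monoˡ-≤ (- ∣ q ∣) (ℚₚ.∣p+q∣≤∣p∣+∣q∣ (p - q) q) ⟩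
    (∣ p - q ∣ + ∣ q ∣) - ∣ q ∣   ≡⟨ ℚₚ.+-assoc ∣ p - q ∣ ∣ q ∣ (- ∣ q ∣) ⟩
    ∣ p - q ∣ + (∣ q ∣ - ∣ q ∣)   ≡⟨ cong (λ r → ∣ p - q ∣ + r) (p-p≡0 ∣ q ∣) ⟩
    ∣ p - q ∣ + 0ℚ                ≡⟨ ℚₚ.+-identityʳ ∣ p - q ∣ ⟩
    ∣ p - q ∣                     ∎
    where open ℚₚ.≤-Reasoning

  ∣∣p∣-∣q∣∣≤∣p-q∣ : ∀ p q → ∣ ∣ p ∣ - ∣ q ∣ ∣ ≤ ∣ p - q ∣
  ∣∣p∣-∣q∣∣≤∣p-q∣ p q with ℚₚ.∣p∣≡p∨∣p∣≡-p (∣ p ∣ - ∣ q ∣)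
  ... | inj₁ eq = subst (_≤ ∣ p - q ∣) (sym eq) (∣p∣-∣q∣≤∣p-q∣ p q)
  ... | inj₂ eq = subst₂ _≤_ (sym (trans eq (neg-sub ∣ p ∣ ∣ q ∣))) (∣p-q∣≡∣q-p∣ q p)
                    (∣p∣-∣q∣≤∣p-q∣ q p)

open ℚ-Lemmas

fromℚ : ℚ → ℝ
fromℚ q = mkℝ (λ _ → q)
  (λ ε 0<ε → 0 , λ _ _ _ _ → subst (λ r → ∣ r ∣ < ε) (sym (p-p≡0 q)) 0<ε)

_-ᵣ_ : ℝ → ℝ → ℝ
seq (x -ᵣ y) n = seq x n - seq y n
cauchy (x -ᵣ y) ε 0<ε with cauchy x (½ * ε) (½ε>0 0<ε) | cauchy y (½ * ε) (½ε>0 0<ε)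
... | M , hx | N , hy = M ℕ.⊔ N , λ m n K≤m K≤n → begin-strict
    ∣ (seq x m - seq y m) - (seq x n - seq y n) ∣
      ≡⟨ cong ∣_∣ (sub-sub (seq x m) (seq y m) (seq x n) (seq y n)) ⟩
    ∣ (seq x m - seq x n) - (seq y m - seq y n) ∣
      ≤⟨ ℚₚ.∣p-q∣≤∣p∣+∣q∣ (seq x m - seq x n) (seq y m - seq y n) ⟩
    ∣ seq x m - seq x n ∣ + ∣ seq y m - seq y n ∣
      <⟨ ℚₚ.+-mono-<
           (hx m n (ℕₚ.m⊔n≤o⇒m≤o M N K≤m) (ℕₚ.m⊔n≤o⇒m≤o M N K≤n))
           (hy m n (ℕₚ.m⊔n≤o⇒n≤o M N K≤m) (ℕₚ.m⊔n≤o⇒n≤o M N K≤n)) ⟩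
    ½ * ε + ½ * ε
      ≡⟨ ½ε+½ε≡ε ε ⟩
    ε ∎
  where open ℚₚ.≤-Reasoning

∣_∣ᵣ : ℝ → ℝ
seq ∣ x ∣ᵣ n = ∣ seq x n ∣
cauchy ∣ x ∣ᵣ ε 0<ε with cauchy x ε 0<ε
... | N , h = N , λ m n N≤m N≤n →
  ℚₚ.≤-<-trans (∣∣p∣-∣q∣∣≤∣p-q∣ (seq x m) (seq x n)) (h m n N≤m N≤n)

Irrational : ℝ → Set
Irrational x = ∀ q → ¬ (x ≃ fromℚ q)

-- 1 / n, with the convention 1 / 0 = 0; only ever used for n ≥ 1.
recip : ℕ → ℚ
recip zero        = 0ℚ
recip n@(suc _)   = + 1 / n

Liouville : ℝ → Set
Liouville x = ∀ m → 1 ℕ.≤ m →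
  Σ[ P ∈ ℤ ] Σ[ Q ∈ ℕ ] Σ[ 2≤Q ∈ 2 ℕ.≤ Q ]
    (let instance
           Q≢0 : NonZero Q
           Q≢0 = >-nonZero (ℕₚ.≤-trans (s≤s z≤n) 2≤Q)
         d = ∣ x -ᵣ fromℚ (P / Q) ∣ᵣ
     in (fromℚ 0ℚ <ᵣ d) × (d <ᵣ fromℚ (recip (Q ^ m))))

------------------------------------------------------------------------
-- Denominator tuples

data Convention : Set where
  weak strict : Convention

Rel : Convention → ℕ → ℕ → Set
Rel weak   = ℕ._≤_
Rel strict = ℕ._<_

InE : Convention → ∀ {n} → Vec ℕ n → Set
InE σ a = All (2 ℕ.≤_) a × Linked (Rel σ) a

sumRecip : ∀ {n} → Vec ℕ n → ℚ
sumRecip []       = 0ℚ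
sumRecip (a ∷ as) = recip a + sumRecip as

Attainable : Convention → ℕ → ℝ → ℚ → Set
Attainable σ n μ r =
  Σ[ a ∈ Vec ℕ n ] (InE σ a × sumRecip a ≡ r × fromℚ r <ᵣ μ)

-- IsR σ n μ r says that the maximum defining R_n^σ(μ) exists and equals r.
IsR : Convention → ℕ → ℝ → ℚ → Set
IsR σ n μ r = Attainable σ n μ r × (∀ s → Attainable σ n μ s → s ≤ r)

IsMaximizing : Convention → ∀ {n} → ℝ → Vec ℕ n → Set
IsMaximizing σ {n} μ a = InE σ a × IsR σ n μ (sumRecip a)

IsUniqueMaximizing : Convention → ∀ {n} → ℝ → Vec ℕ n → Set
IsUniqueMaximizing σ {n} μ a =
  IsMaximizing σ μ a × (∀ (b : Vec ℕ n) → IsMaximizing σ μ b → b ≡ a)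

------------------------------------------------------------------------
-- Greedy denominators
--
-- Sequences are indexed from 0, so g i is the mathematical g_{i+1}.

firstTerms : (ℕ → ℕ) → ∀ n → Vec ℕ n
firstTerms g n = tabulate (λ (i : Fin n) → g (toℕ i))

FollowsPrevious : Convention → (ℕ → ℕ) → ℕ → ℕ → Set
FollowsPrevious σ g zero    x = ⊤
FollowsPrevious σ g (suc i) x = Rel σ (g i) x

GreedyCandidate : Convention → ℝ → (ℕ → ℕ) → ℕ → ℕ → Set
GreedyCandidate σ μ g i x =
  2 ℕ.≤ x × FollowsPrevious σ g i x ×
  fromℚ (recip x) <ᵣ μ -ᵣ fromℚ (sumRecip (firstTerms g i))

-- Each g i is the least candidate given g 0 , … , g (i - 1), so a
-- sequence satisfying this is determined by σ and μ.
IsGreedy : Convention → ℝ → (ℕ → ℕ) → Set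
IsGreedy σ μ g = ∀ i →
  GreedyCandidate σ μ g i (g i) ×
  (∀ x → GreedyCandidate σ μ g i x → g i ℕ.≤ x)

------------------------------------------------------------------------
-- θ = Σ_{n ≥ 1} 1 / 2^{n!}

θ-term : ℕ → ℚ
θ-term n = recip (2 ^ (n !))

-- The sum of the terms with index 1 , … , N.
θ-partial : ℕ → ℚ
θ-partial zero    = 0ℚ
θ-partial (suc N) = θ-partial N + θ-term (suc N)

module θ-Lemmas where
  recip-suc : ∀ n → ℚᵘ.mkℚᵘ (+ 1) n ℚᵘ.≃ ℚ.toℚᵘ (recip (suc n))
  recip-suc n = ℚᵘₚ.≃-sym (ℚₚ.toℚᵘ-fromℚᵘ (ℚᵘ.mkℚᵘ (+ 1) n))

  recip-anti : ∀ {m n} → 1 ℕ.≤ m → m ℕ.≤ n → recip n ≤ recip m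
  recip-anti {suc m} {suc n} _ m≤n = ℚₚ.toℚᵘ-cancel-≤
    (ℚᵘₚ.≤-respˡ-≃ (recip-suc n) (ℚᵘₚ.≤-respʳ-≃ (recip-suc m)
      (ℚᵘ.*≤* (ℤₚ.*-monoˡ-≤-nonNeg (+ 1) (ℤ.+≤+ m≤n)))))

  0≤recip : ∀ n → 0ℚ ≤ recip n
  0≤recip zero    = ℚₚ.≤-refl
  0≤recip (suc n) = ℚₚ.toℚᵘ-cancel-≤
    (ℚᵘₚ.≤-respʳ-≃ (recip-suc n) (ℚᵘ.*≤* (ℤ.+≤+ z≤n)))

  recip-double : ∀ k → recip (2 ℕ.* suc k) + recip (2 ℕ.* suc k) ≡ recip (suc k)
  recip-double k = ℚₚ.toℚᵘ-injective (begin
    ℚ.toℚᵘ (recip (suc j) + recip (suc j))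
      ≈⟨ ℚₚ.toℚᵘ-homo-+ (recip (suc j)) (recip (suc j)) ⟩
    ℚ.toℚᵘ (recip (suc j)) ℚᵘ.+ ℚ.toℚᵘ (recip (suc j))
      ≈⟨ ℚᵘₚ.+-cong (recip-suc j) (recip-suc j) ⟨
    ℚᵘ.mkℚᵘ (+ 1) j ℚᵘ.+ ℚᵘ.mkℚᵘ (+ 1) j
      ≈⟨ ℚᵘ.*≡* (cong +_ eq) ⟩
    ℚᵘ.mkℚᵘ (+ 1) k
      ≈⟨ recip-suc k ⟩
    ℚ.toℚᵘ (recip (suc k)) ∎)
    where
    open ℚᵘₚ.≃-Reasoning
    j : ℕ
    j = k ℕ.+ suc (k ℕ.+ 0)
    eq : (1 ℕ.* suc j ℕ.+ 1 ℕ.* suc j) ℕ.* suc k ≡ 1 ℕ.* (suc j ℕ.* suc j)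
    eq = solve 1 (λ K → (con 1 :* (con 2 :* K) :+ con 1 :* (con 2 :* K)) :* K
                      := con 1 :* ((con 2 :* K) :* (con 2 :* K))) refl (suc k)
      where open ℕSolver.+-*-Solver

  recip-2^ : ∀ n → recip (2 ^ suc n) + recip (2 ^ suc n) ≡ recip (2 ^ n)
  recip-2^ n with 2 ^ n | ℕₚ.m^n>0 2 n
  ... | suc k | _ = recip-double k

  n≤n! : ∀ n → n ℕ.≤ n !
  n≤n! zero    = z≤n
  n≤n! (suc n) = ℕₚ.m≤m*n (suc n) (n !) {{>-nonZero (ℕₚ.1≤n! n)}}

  n<2^n : ∀ n → n ℕ.< 2 ^ n
  n<2^n zero    = s≤s z≤n
  n<2^n (suc n) = ℕₚ.+-mono-≤ (ℕₚ.m^n>0 2 n)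
    (ℕₚ.≤-trans (n<2^n n) (ℕₚ.m≤m+n (2 ^ n) 0))

  θ-term≤ : ∀ n → θ-term n ≤ recip (2 ^ n)
  θ-term≤ n = recip-anti (ℕₚ.m^n>0 2 n) (ℕₚ.^-monoʳ-≤ 2 (n≤n! n))

  θ-lower : ∀ k n → θ-partial n ≤ θ-partial (k ℕ.+ n)
  θ-lower zero    n = ℚₚ.≤-refl
  θ-lower (suc k) n = ℚₚ.≤-trans (θ-lower k n)
    (subst (_≤ θ-partial (suc k ℕ.+ n)) (ℚₚ.+-identityʳ (θ-partial (k ℕ.+ n)))
      (ℚₚ.+-monoʳ-≤ (θ-partial (k ℕ.+ n)) (0≤recip (2 ^ (suc (k ℕ.+ n) !)))))

  θ-upper : ∀ k n → θ-partial (k ℕ.+ n) + recip (2 ^ (k ℕ.+ n)) ≤ θ-partial n + recip (2 ^ n)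
  θ-upper zero    n = ℚₚ.≤-refl
  θ-upper (suc k) n = ℚₚ.≤-trans step (θ-upper k n)
    where
    open ℚₚ.≤-Reasoning
    l = k ℕ.+ n
    step : θ-partial (suc l) + recip (2 ^ suc l) ≤ θ-partial l + recip (2 ^ l)
    step = begin
      (θ-partial l + θ-term (suc l)) + recip (2 ^ suc l)
        ≡⟨ ℚₚ.+-assoc (θ-partial l) (θ-term (suc l)) (recip (2 ^ suc l)) ⟩
      θ-partial l + (θ-term (suc l) + recip (2 ^ suc l))
        ≤⟨ ℚₚ.+-monoʳ-≤ (θ-partial l)
             (ℚₚ.+-monoˡ-≤ (recip (2 ^ suc l)) (θ-term≤ (suc l))) ⟩
      θ-partial l + (recip (2 ^ suc l) + recip (2 ^ suc l))
        ≡⟨ cong (λ r → θ-partial l + r) (recip-2^ l) ⟩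
      θ-partial l + recip (2 ^ l) ∎

  θ-gap : ∀ {n m} → n ℕ.≤ m → ∣ θ-partial m - θ-partial n ∣ ≤ recip (2 ^ n)
  θ-gap {n} {m} n≤m = subst (λ l → ∣ θ-partial l - θ-partial n ∣ ≤ recip (2 ^ n))
                            (ℕₚ.m∸n+n≡m n≤m) (gap (m ℕ.∸ n))
    where
    open ℚₚ.≤-Reasoning
    gap : ∀ k → ∣ θ-partial (k ℕ.+ n) - θ-partial n ∣ ≤ recip (2 ^ n)
    gap k = begin
      ∣ A - B ∣                     ≡⟨ ℚₚ.0≤p⇒∣p∣≡p 0≤A-B ⟩
      A - B                         ≡⟨ ℚₚ.+-identityʳ (A - B) ⟨
      (A - B) + 0ℚ                  ≤⟨ ℚₚ.+-monoʳ-≤ (A - B) (0≤recip (2 ^ (k ℕ.+ n))) ⟩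
      (A - B) + C                   ≡⟨ swap-sub A C B ⟨
      (A + C) - B                   ≤⟨ ℚₚ.+-monoˡ-≤ (- B) (θ-upper k n) ⟩
      (B + recip (2 ^ n)) - B       ≡⟨ swap-sub B (recip (2 ^ n)) B ⟩
      (B - B) + recip (2 ^ n)       ≡⟨ cong (_+ recip (2 ^ n)) (p-p≡0 B) ⟩
      0ℚ + recip (2 ^ n)            ≡⟨ ℚₚ.+-identityˡ (recip (2 ^ n)) ⟩
      recip (2 ^ n)                 ∎
      where
      A = θ-partial (k ℕ.+ n)
      B = θ-partial n
      C = recip (2 ^ (k ℕ.+ n))
      0≤A-B : 0ℚ ≤ A - B
      0≤A-B = subst (_≤ A - B) (p-p≡0 B) (ℚₚ.+-monoˡ-≤ (- B) (θ-lower k n))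

  archimedean : ∀ ε → 0ℚ < ε → ∃[ N ] recip (suc N) < ε
  archimedean ε@(mkℚ (+ zero) d _) (*<* (ℤ.+<+ ()))
  archimedean ε@(mkℚ (ℤ.-[1+ p ]) d _) (*<* ())
  archimedean ε@(mkℚ (+ suc p) d _) _ = suc d , ℚₚ.toℚᵘ-cancel-<
    (ℚᵘₚ.<-respˡ-≃ (recip-suc (suc d)) (ℚᵘ.*<* (ℤ.+<+ lt)))
    where
    lt : 1 ℕ.* suc d ℕ.< suc p ℕ.* suc (suc d)
    lt = ℕₚ.*-mono-≤ {1} {suc p} {suc (suc d)} {suc (suc d)} (s≤s z≤n) ℕₚ.≤-refl

  θ-gap-N : ∀ N n m → N ℕ.≤ n → N ℕ.≤ m → ∣ θ-partial m - θ-partial n ∣ ≤ recip (2 ^ N)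
  θ-gap-N N n m N≤n N≤m with ℕₚ.≤-total n m
  ... | inj₁ n≤m = ℚₚ.≤-trans (θ-gap n≤m) (recip-anti (ℕₚ.m^n>0 2 N) (ℕₚ.^-monoʳ-≤ 2 N≤n))
  ... | inj₂ m≤n = subst (_≤ recip (2 ^ N)) (∣p-q∣≡∣q-p∣ (θ-partial n) (θ-partial m))
    (ℚₚ.≤-trans (θ-gap m≤n) (recip-anti (ℕₚ.m^n>0 2 N) (ℕₚ.^-monoʳ-≤ 2 N≤m)))

  θ-cauchy : IsCauchy θ-partial
  θ-cauchy ε 0<ε with archimedean ε 0<ε
  ... | N , lt = N , λ m n N≤m N≤n →
    ℚₚ.≤-<-trans (θ-gap-N N n m N≤n N≤m)
      (ℚₚ.≤-<-trans (recip-anti (s≤s z≤n) (n<2^n N)) lt)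

θ : ℝ
θ = mkℝ θ-partial θ-Lemmas.θ-cauchy

{-# OPTIONS --safe #-}

-- Write M = 2^((n+1)!) for the (n+1)-st greedy denominator and s_n for the
-- n-th partial sum of θ, a fraction with denominator 2^(n!).  Since
-- the next denominator is at least M², s_n < θ < s_n + 1/(M − 1).
-- So the s_n are Liouville approximations, too good for θ to be rational.
--
-- Upper bound: let b be admissible with last entry y, and let its first n
-- entries have reciprocal sum at most s_n (induction).  If the whole sum
-- exceeded s_{n+1}, then y < M, so the excess is a positive fraction with
-- denominator at most y^(n+1) M < M^(n+2), the next greedy denominator G;
-- hence it is at least 1/(G − 1), putting the sum above θ.
--
-- Uniqueness: if the sum equals s_{n+1}, then y ≤ M.  If y < M, all entries
-- are below the power of two M, so the 2-adic valuation of 1/M = Σ 1/b_i − s_n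
-- would be larger than it is.  So y = M, and the first n entries sum to s_n.

module Submission where

open import Defs
open import Data.Nat.Base using (ℕ; _≤_)
open import Data.Product.Base using (_×_; Σ-syntax)

open import Algebra.Properties.Group using (∙-cancelʳ)
open import Data.Empty using (⊥-elim)
open import Data.Fin.Base using (toℕ)
open import Data.Integer.Base as ℤ using (ℤ; +_)
import Data.Integer.Properties as ℤₚ
open import Data.Nat.Base as ℕ
  using (zero; suc; pred; _<_; _+_; _*_; _^_; _!; z≤n; s≤s; NonZero; >-nonZero; >-nonZero⁻¹)
open import Data.Nat.Divisibility
  using (_∣_; divides; m∣m*n; n∣m*n; *-monoʳ-∣)
import Data.Nat.Properties as ℕₚ
import Data.Nat.Solver as ℕSolver
open import Data.Product.Base using (∃-syntax; _,_; proj₁; proj₂)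
open import Data.Rational.Base as ℚ using (ℚ; 0ℚ; 1ℚ; _/_)
import Data.Rational.Properties as ℚₚ
open import Data.Rational.Solver using (module +-*-Solver)
import Data.Rational.Unnormalised.Base as ℚᵘ
import Data.Rational.Unnormalised.Properties as ℚᵘₚ
open import Data.Sum.Base using (_⊎_; inj₁; inj₂)
open import Data.Unit.Base using (tt)
open import Data.Vec.Base using (Vec; []; _∷_; _∷ʳ_; initLast)
open import Data.Vec.Relation.Unary.All using (All; []; _∷_)
open import Data.Vec.Relation.Unary.All.Properties using (tabulate⁺)
open import Data.Vec.Relation.Unary.Linked as Linked using (Linked; []; [-]; _∷_)
open import Relation.Binary.PropositionalEquality
open import Relation.Nullary using (¬_; yes; no)

open θ-Lemmas
  using (recip-suc; recip-anti; recip-double; n≤n!; n<2^n; θ-lower)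

-- Rational arithmetic and denominators

private
  variable
    p q r : ℚ
    D d k n : ℕ

p<q⇒0<q-p : p ℚ.< q → 0ℚ ℚ.< q ℚ.- p
p<q⇒0<q-p {p} {q} p<q =
  subst (ℚ._< q ℚ.- p) (ℚₚ.+-inverseʳ p) (ℚₚ.+-monoˡ-< (ℚ.- p) p<q)

p+[q-p]≡q : ∀ p q → p ℚ.+ (q ℚ.- p) ≡ q
p+[q-p]≡q = solve 2 (λ p q → p :+ (q :- p) := q) refl
  where open +-*-Solver

[p+q]-p≡q : ∀ p q → (p ℚ.+ q) ℚ.- p ≡ q
[p+q]-p≡q = solve 2 (λ p q → (p :+ q) :- p := q) refl
  where open +-*-Solver

r≤q-p⇒p+r≤q : r ℚ.≤ q ℚ.- p → p ℚ.+ r ℚ.≤ q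
r≤q-p⇒p+r≤q {r} {q} {p} r≤q-p =
  subst (p ℚ.+ r ℚ.≤_) (p+[q-p]≡q p q) (ℚₚ.+-monoʳ-≤ p r≤q-p)

p+r≤q⇒r≤q-p : p ℚ.+ r ℚ.≤ q → r ℚ.≤ q ℚ.- p
p+r≤q⇒r≤q-p {p} {r} {q} p+r≤q =
  subst (ℚ._≤ q ℚ.- p) ([p+q]-p≡q p r) (ℚₚ.+-monoˡ-≤ (ℚ.- p) p+r≤q)

p<p+q : ∀ p → 0ℚ ℚ.< q → p ℚ.< p ℚ.+ q
p<p+q {q} p 0<q = subst (ℚ._< p ℚ.+ q) (ℚₚ.+-identityʳ p) (ℚₚ.+-monoʳ-< p 0<q)

p≤∣p∣ : ∀ p → p ℚ.≤ ℚ.∣ p ∣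
p≤∣p∣ p with ℚₚ.≤-total 0ℚ p
... | inj₁ 0≤p = ℚₚ.≤-reflexive (sym (ℚₚ.0≤p⇒∣p∣≡p 0≤p))
... | inj₂ p≤0 = ℚₚ.≤-trans p≤0 (ℚₚ.0≤∣p∣ p)

fromℤ : ℤ → ℚ
fromℤ i = i / 1

fromℕ : ℕ → ℚ
fromℕ n = fromℤ (+ n)

toℚᵘ-fromℤ : ∀ i → ℚ.toℚᵘ (fromℤ i) ℚᵘ.≃ ℚᵘ.mkℚᵘ i 0
toℚᵘ-fromℤ i = ℚₚ.toℚᵘ-fromℚᵘ (ℚᵘ.mkℚᵘ i 0)

fromℤ-+ : ∀ i j → fromℤ (i ℤ.+ j) ≡ fromℤ i ℚ.+ fromℤ j
fromℤ-+ i j = ℚₚ.toℚᵘ-injective (begin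
  ℚ.toℚᵘ (fromℤ (i ℤ.+ j))                 ≈⟨ toℚᵘ-fromℤ (i ℤ.+ j) ⟩
  ℚᵘ.mkℚᵘ (i ℤ.+ j) 0                      ≈⟨ ℚᵘ.*≡* (cong (ℤ._* + 1) (sym (cong₂ ℤ._+_ (ℤₚ.*-identityʳ i) (ℤₚ.*-identityʳ j)))) ⟩
  ℚᵘ.mkℚᵘ i 0 ℚᵘ.+ ℚᵘ.mkℚᵘ j 0             ≈⟨ ℚᵘₚ.+-cong (toℚᵘ-fromℤ i) (toℚᵘ-fromℤ j) ⟨
  ℚ.toℚᵘ (fromℤ i) ℚᵘ.+ ℚ.toℚᵘ (fromℤ j)   ≈⟨ ℚₚ.toℚᵘ-homo-+ (fromℤ i) (fromℤ j) ⟨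
  ℚ.toℚᵘ (fromℤ i ℚ.+ fromℤ j)             ∎)
  where open ℚᵘₚ.≃-Reasoning

fromℤ-* : ∀ i j → fromℤ (i ℤ.* j) ≡ fromℤ i ℚ.* fromℤ j
fromℤ-* i j = ℚₚ.toℚᵘ-injective (begin
  ℚ.toℚᵘ (fromℤ (i ℤ.* j))                 ≈⟨ toℚᵘ-fromℤ (i ℤ.* j) ⟩
  ℚᵘ.mkℚᵘ i 0 ℚᵘ.* ℚᵘ.mkℚᵘ j 0             ≈⟨ ℚᵘₚ.*-cong (toℚᵘ-fromℤ i) (toℚᵘ-fromℤ j) ⟨
  ℚ.toℚᵘ (fromℤ i) ℚᵘ.* ℚ.toℚᵘ (fromℤ j)   ≈⟨ ℚₚ.toℚᵘ-homo-* (fromℤ i) (fromℤ j) ⟨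
  ℚ.toℚᵘ (fromℤ i ℚ.* fromℤ j)             ∎)
  where open ℚᵘₚ.≃-Reasoning

fromℤ-neg : ∀ i → fromℤ (ℤ.- i) ≡ ℚ.- fromℤ i
fromℤ-neg i = ℚₚ.toℚᵘ-injective (begin
  ℚ.toℚᵘ (fromℤ (ℤ.- i))   ≈⟨ toℚᵘ-fromℤ (ℤ.- i) ⟩
  ℚᵘ.- ℚᵘ.mkℚᵘ i 0         ≈⟨ ℚᵘₚ.-‿cong (toℚᵘ-fromℤ i) ⟨
  ℚᵘ.- ℚ.toℚᵘ (fromℤ i)    ≈⟨ ℚₚ.toℚᵘ-homo‿- (fromℤ i) ⟨
  ℚ.toℚᵘ (ℚ.- fromℤ i)     ∎)
  where open ℚᵘₚ.≃-Reasoning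

fromℕ-* : ∀ m n → fromℕ (m * n) ≡ fromℕ m ℚ.* fromℕ n
fromℕ-* m n = trans (cong fromℤ (ℤₚ.pos-* m n)) (fromℤ-* (+ m) (+ n))

fromℤ-injective : ∀ i j → fromℤ i ≡ fromℤ j → i ≡ j
fromℤ-injective i j eq with ℚₚ./-injective-≃ (ℚᵘ.mkℚᵘ i 0) (ℚᵘ.mkℚᵘ j 0) eq
... | ℚᵘ.*≡* i*1≡j*1 = trans (sym (ℤₚ.*-identityʳ i)) (trans i*1≡j*1 (ℤₚ.*-identityʳ j))

fromℤ-mono-≤ : ∀ {i j} → i ℤ.≤ j → fromℤ i ℚ.≤ fromℤ j
fromℤ-mono-≤ {i} {j} i≤j = ℚₚ.toℚᵘ-cancel-≤
  (ℚᵘₚ.≤-respˡ-≃ (ℚᵘₚ.≃-sym (toℚᵘ-fromℤ i)) (ℚᵘₚ.≤-respʳ-≃ (ℚᵘₚ.≃-sym (toℚᵘ-fromℤ j))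
    (ℚᵘ.*≤* (ℤₚ.*-monoʳ-≤-nonNeg (+ 1) i≤j))))

fromℕ-positive : ∀ n .{{_ : NonZero n}} → ℚ.Positive (fromℕ n)
fromℕ-positive n = ℚₚ.normalize-pos n 1

recip*fromℕ≡1 : ∀ n .{{_ : NonZero n}} → recip n ℚ.* fromℕ n ≡ 1ℚ
recip*fromℕ≡1 n@(suc k) = ℚₚ.toℚᵘ-injective (begin
  ℚ.toℚᵘ (recip n ℚ.* fromℕ n)               ≈⟨ ℚₚ.toℚᵘ-homo-* (recip n) (fromℕ n) ⟩
  ℚ.toℚᵘ (recip n) ℚᵘ.* ℚ.toℚᵘ (fromℕ n)     ≈⟨ ℚᵘₚ.*-cong (ℚᵘₚ.≃-sym (recip-suc k)) (toℚᵘ-fromℤ (+ n)) ⟩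
  ℚᵘ.mkℚᵘ (+ 1) k ℚᵘ.* ℚᵘ.mkℚᵘ (+ n) 0       ≈⟨ ℚᵘ.*≡* (cong +_ (solve 1 (λ x → con 1 :* x :* con 1 := con 1 :* (x :* con 1)) refl n)) ⟩
  ℚᵘ.1ℚᵘ                                     ∎)
  where
  open ℚᵘₚ.≃-Reasoning
  open ℕSolver.+-*-Solver

0<recip : ∀ n .{{_ : NonZero n}} → 0ℚ ℚ.< recip n
0<recip n@(suc _) = ℚₚ.positive⁻¹ (recip n) {{ℚₚ.normalize-pos 1 n}}

-- The partial fraction identity 1/n = 1/(n+1) + 1/(n(n+1)); it serves both the strict monotonicity
-- of `recip` and the telescoping bound on the tail of θ.
recip-split : ∀ n .{{_ : NonZero n}} → recip (suc n) ℚ.+ recip (n * suc n) ≡ recip n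
recip-split n@(suc k) = ℚₚ.toℚᵘ-injective (begin
  ℚ.toℚᵘ (recip (suc n) ℚ.+ recip (n * suc n))
    ≈⟨ ℚₚ.toℚᵘ-homo-+ (recip (suc n)) (recip (n * suc n)) ⟩
  ℚ.toℚᵘ (recip (suc n)) ℚᵘ.+ ℚ.toℚᵘ (recip (n * suc n))
    ≈⟨ ℚᵘₚ.+-cong (recip-suc n) (recip-suc (pred (n * suc n))) ⟨
  ℚᵘ.mkℚᵘ (+ 1) n ℚᵘ.+ ℚᵘ.mkℚᵘ (+ 1) (pred (n * suc n))
    ≈⟨ ℚᵘ.*≡* (cong +_ (solve 1
         (λ x → (con 1 :* (x :* (con 1 :+ x)) :+ con 1 :* (con 1 :+ x)) :* x
             := con 1 :* ((con 1 :+ x) :* (x :* (con 1 :+ x)))) refl n)) ⟩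
  ℚᵘ.mkℚᵘ (+ 1) k
    ≈⟨ recip-suc k ⟩
  ℚ.toℚᵘ (recip n) ∎)
  where
  open ℚᵘₚ.≃-Reasoning
  open ℕSolver.+-*-Solver

-- Says that `q` is an integer multiple of 1/`D`, not that `D` is the reduced denominator, so common
-- denominators of sums need no gcd.
record HasDen (D : ℕ) (q : ℚ) : Set where
  constructor hasDen
  field
    num     : ℤ
    q*D≡num : q ℚ.* fromℕ D ≡ fromℤ num

hasDen-0 : ∀ D → HasDen D 0ℚ
hasDen-0 D = hasDen (+ 0) (ℚₚ.*-zeroˡ (fromℕ D))

hasDen-+ : HasDen D p → HasDen D q → HasDen D (p ℚ.+ q)
hasDen-+ {D} {p} {q} (hasDen i pD≡i) (hasDen j qD≡j) = hasDen (i ℤ.+ j)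
  (trans (ℚₚ.*-distribʳ-+ (fromℕ D) p q) (trans (cong₂ ℚ._+_ pD≡i qD≡j) (sym (fromℤ-+ i j))))

hasDen-neg : HasDen D p → HasDen D (ℚ.- p)
hasDen-neg {D} {p} (hasDen i pD≡i) = hasDen (ℤ.- i)
  (trans (sym (ℚₚ.neg-distribˡ-* p (fromℕ D))) (trans (cong ℚ.-_ pD≡i) (sym (fromℤ-neg i))))

hasDen-- : HasDen D p → HasDen D q → HasDen D (p ℚ.- q)
hasDen-- hp hq = hasDen-+ hp (hasDen-neg hq)

hasDen-∣ : d ∣ D → HasDen d q → HasDen D q
hasDen-∣ {d} {q = q} (divides c refl) (hasDen i qd≡i) = hasDen (+ c ℤ.* i) (begin
  q ℚ.* fromℕ (c * d)             ≡⟨ cong (q ℚ.*_) (fromℕ-* c d) ⟩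
  q ℚ.* (fromℕ c ℚ.* fromℕ d)     ≡⟨ solve 3 (λ q c d → q :* (c :* d) := c :* (q :* d))
                                       refl q (fromℕ c) (fromℕ d) ⟩
  fromℕ c ℚ.* (q ℚ.* fromℕ d)     ≡⟨ cong (fromℕ c ℚ.*_) qd≡i ⟩
  fromℕ c ℚ.* fromℤ i             ≡⟨ fromℤ-* (+ c) i ⟨
  fromℤ (+ c ℤ.* i)               ∎)
  where
  open ≡-Reasoning
  open +-*-Solver

hasDen-recip : ∀ n .{{_ : NonZero n}} → HasDen n (recip n)
hasDen-recip n = hasDen (+ 1) (recip*fromℕ≡1 n)

hasDen-↧ : ∀ q → HasDen (ℚ.↧ₙ q) q
hasDen-↧ q@(ℚ.mkℚ _ _ _) = hasDen (ℚ.↥ q) (ℚₚ.toℚᵘ-injective (begin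
  ℚ.toℚᵘ (q ℚ.* fromℕ (ℚ.↧ₙ q))                ≈⟨ ℚₚ.toℚᵘ-homo-* q (fromℕ (ℚ.↧ₙ q)) ⟩
  ℚ.toℚᵘ q ℚᵘ.* ℚ.toℚᵘ (fromℕ (ℚ.↧ₙ q))        ≈⟨ ℚᵘₚ.*-congˡ {ℚ.toℚᵘ q} (toℚᵘ-fromℤ (ℚ.↧ q)) ⟩
  ℚ.toℚᵘ q ℚᵘ.* ℚᵘ.mkℚᵘ (ℚ.↧ q) 0              ≈⟨ ℚᵘ.*≡* (trans (ℤₚ.*-identityʳ _)
                                                    (cong (λ d → ℚ.↥ q ℤ.* (+ d)) (sym (ℕₚ.*-identityʳ (ℚ.↧ₙ q))))) ⟩
  ℚᵘ.mkℚᵘ (ℚ.↥ q) 0                            ≈⟨ toℚᵘ-fromℤ (ℚ.↥ q) ⟨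
  ℚ.toℚᵘ (fromℤ (ℚ.↥ q))                       ∎))
  where open ℚᵘₚ.≃-Reasoning

hasDen-/ : ∀ D .{{_ : NonZero D}} → HasDen D q → ∃[ i ] q ≡ i / D
hasDen-/ {q} D@(suc k) (hasDen i qD≡i) = i , (begin
  q                                     ≡⟨ ℚₚ.*-identityʳ q ⟨
  q ℚ.* 1ℚ                              ≡⟨ cong (q ℚ.*_) (recip*fromℕ≡1 D) ⟨
  q ℚ.* (recip D ℚ.* fromℕ D)           ≡⟨ solve 3 (λ q r d → q :* (r :* d) := (q :* d) :* r)
                                             refl q (recip D) (fromℕ D) ⟩
  (q ℚ.* fromℕ D) ℚ.* recip D           ≡⟨ cong (ℚ._* recip D) qD≡i ⟩
  fromℤ i ℚ.* recip D                   ≡⟨ ℚₚ.toℚᵘ-injective lemma ⟩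
  i / D                                 ∎)
  where
  open ≡-Reasoning
  open +-*-Solver
  lemma : ℚ.toℚᵘ (fromℤ i ℚ.* recip D) ℚᵘ.≃ ℚ.toℚᵘ (i / D)
  lemma = ℚᵘₚ.≃-trans (ℚₚ.toℚᵘ-homo-* (fromℤ i) (recip D))
    (ℚᵘₚ.≃-trans (ℚᵘₚ.*-cong (toℚᵘ-fromℤ i) (ℚᵘₚ.≃-sym (recip-suc k)))
      (ℚᵘₚ.≃-trans (ℚᵘ.*≡* (cong₂ ℤ._*_ (ℤₚ.*-identityʳ i) (cong +_ (sym (ℕₚ.*-identityˡ D)))))
        (ℚᵘₚ.≃-sym (ℚₚ.toℚᵘ-fromℚᵘ (ℚᵘ.mkℚᵘ i k)))))

-- The numerator over `D` is a positive integer, hence at least 1. The upper bound on sums and the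
-- irrationality of θ both take their lower bound on a gap from here.
recip≤ : ∀ D .{{_ : NonZero D}} → HasDen D q → 0ℚ ℚ.< q → recip D ℚ.≤ q
recip≤ {q} D (hasDen i qD≡i) 0<q = ℚₚ.*-cancelʳ-≤-pos (fromℕ D) {{fromℕ-positive D}}
  (subst₂ ℚ._≤_ (sym (recip*fromℕ≡1 D)) (sym qD≡i) (fromℤ-mono-≤ {+ 1} {i} 1≤i))
  where
  0<i : fromℤ (+ 0) ℚ.< fromℤ i
  0<i = subst₂ ℚ._<_ (ℚₚ.*-zeroˡ (fromℕ D)) qD≡i
          (ℚₚ.*-monoˡ-<-pos (fromℕ D) {{fromℕ-positive D}} 0<q)
  1≤i : + 1 ℤ.≤ i
  1≤i with i ℤₚ.≤? + 0
  ... | yes i≤0 = ⊥-elim (ℚₚ.<-irrefl refl (ℚₚ.<-≤-trans 0<i (fromℤ-mono-≤ i≤0)))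
  ... | no i≰0 = ℤₚ.i<j⇒suc[i]≤j (ℤₚ.≰⇒> i≰0)

-- 2-adic valuation

parity : ∀ n → (∃[ m ] n ≡ 2 * m) ⊎ (∃[ m ] n ≡ suc (2 * m))
parity zero = inj₁ (0 , refl)
parity (suc n) with parity n
... | inj₁ (m , refl) = inj₂ (m , refl)
... | inj₂ (m , refl) = inj₁ (suc m , sym (ℕₚ.*-suc 2 m))

-- Halve `b` while it is even: below 2^(k+1) at most `k` halvings are possible, and an odd factor
-- remains.
∣2^k*odd : ∀ k b .{{_ : NonZero b}} → b < 2 ^ suc k → ∃[ o ] b ∣ 2 ^ k * suc (2 * o)
∣2^k*odd k b b<2^ with parity b
... | inj₂ (m , refl) = m , n∣m*n (2 ^ k)
∣2^k*odd zero    _ b<2^ | inj₁ (suc m , refl) =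
  ⊥-elim (ℕₚ.<⇒≱ b<2^ (ℕₚ.*-monoʳ-≤ 2 (s≤s z≤n)))
∣2^k*odd (suc k) _ b<2^ | inj₁ (m@(suc _) , refl)
  with ∣2^k*odd k m (ℕₚ.*-cancelˡ-< 2 m (2 ^ suc k) b<2^)
... | o , m∣ = o , subst (2 * m ∣_) (sym (ℕₚ.*-assoc 2 (2 ^ k) (suc (2 * o)))) (*-monoʳ-∣ 2 m∣)

-- Encodes that the 2-adic valuation of `q` is at least -`k`, through a denominator with exactly `k`
-- factors 2.
2-Val≥- : ℕ → ℚ → Set
2-Val≥- k q = ∃[ o ] HasDen (2 ^ k * suc (2 * o)) q

odd*odd : ∀ a b → suc (2 * a) * suc (2 * b) ≡ suc (2 * (a + b + 2 * a * b))
odd*odd = solve 2 (λ a b → (con 1 :+ con 2 :* a) :* (con 1 :+ con 2 :* b)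
                        := con 1 :+ con 2 :* (a :+ b :+ con 2 :* a :* b)) refl
  where open ℕSolver.+-*-Solver

2-val-+ : 2-Val≥- k p → 2-Val≥- k q → 2-Val≥- k (p ℚ.+ q)
2-val-+ {k} (a , hp) (b , hq) = a + b + 2 * a * b ,
  hasDen-+ (hasDen-∣ (*-monoʳ-∣ (2 ^ k) (subst (suc (2 * a) ∣_) (odd*odd a b) (m∣m*n (suc (2 * b))))) hp)
           (hasDen-∣ (*-monoʳ-∣ (2 ^ k) (subst (suc (2 * b) ∣_) (odd*odd a b) (n∣m*n (suc (2 * a))))) hq)

2-val-neg : 2-Val≥- k p → 2-Val≥- k (ℚ.- p)
2-val-neg (a , hp) = a , hasDen-neg hp

2-val-recip : ∀ k b .{{_ : NonZero b}} → b < 2 ^ suc k → 2-Val≥- k (recip b)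
2-val-recip k b b<2^ with ∣2^k*odd k b b<2^
... | o , b∣ = o , hasDen-∣ b∣ (hasDen-recip b)

-- Clearing denominators in 1/2^(k+1) = i/(2^k · odd) leaves 2i = odd; absolute values move the
-- parity clash to ℕ.
¬2-val-recip-2^ : ∀ k → ¬ 2-Val≥- k (recip (2 ^ suc k))
¬2-val-recip-2^ k (o , hasDen i eq) = ℕₚ.even≢odd ℤ.∣ i ∣ o (begin
  2 * ℤ.∣ i ∣              ≡⟨ ℤₚ.abs-* (+ 2) i ⟨
  ℤ.∣ + 2 ℤ.* i ∣          ≡⟨ cong ℤ.∣_∣ (fromℤ-injective (+ 2 ℤ.* i) (+ suc (2 * o)) 2i≡odd) ⟩
  suc (2 * o)              ∎)
  where
  open ≡-Reasoning
  instance
    2^≢0 : NonZero (2 ^ suc k)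
    2^≢0 = ℕₚ.m^n≢0 2 (suc k)
  2i≡odd : fromℤ (+ 2 ℤ.* i) ≡ fromℕ (suc (2 * o))
  2i≡odd = begin
    fromℤ (+ 2 ℤ.* i)
      ≡⟨ fromℤ-* (+ 2) i ⟩
    fromℕ 2 ℚ.* fromℤ i
      ≡⟨ cong (fromℕ 2 ℚ.*_) eq ⟨
    fromℕ 2 ℚ.* (recip (2 ^ suc k) ℚ.* fromℕ (2 ^ k * suc (2 * o)))
      ≡⟨ cong (λ x → fromℕ 2 ℚ.* (recip (2 ^ suc k) ℚ.* x)) (fromℕ-* (2 ^ k) (suc (2 * o))) ⟩
    fromℕ 2 ℚ.* (recip (2 ^ suc k) ℚ.* (fromℕ (2 ^ k) ℚ.* fromℕ (suc (2 * o))))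
      ≡⟨ solve 4 (λ t r x y → t :* (r :* (x :* y)) := r :* (t :* x) :* y) refl
           (fromℕ 2) (recip (2 ^ suc k)) (fromℕ (2 ^ k)) (fromℕ (suc (2 * o))) ⟩
    recip (2 ^ suc k) ℚ.* (fromℕ 2 ℚ.* fromℕ (2 ^ k)) ℚ.* fromℕ (suc (2 * o))
      ≡⟨ cong (λ x → recip (2 ^ suc k) ℚ.* x ℚ.* fromℕ (suc (2 * o))) (fromℕ-* 2 (2 ^ k)) ⟨
    recip (2 ^ suc k) ℚ.* fromℕ (2 ^ suc k) ℚ.* fromℕ (suc (2 * o))
      ≡⟨ cong (ℚ._* fromℕ (suc (2 * o))) (recip*fromℕ≡1 (2 ^ suc k)) ⟩
    1ℚ ℚ.* fromℕ (suc (2 * o))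
      ≡⟨ ℚₚ.*-identityˡ _ ⟩
    fromℕ (suc (2 * o)) ∎
    where open +-*-Solver

-- The partial sums of θ

-- Indexed from 0 like the greedy sequence, so that `θ-partial (suc n)` unfolds to
-- `θ-partial n ℚ.+ recip (den n)`.
den : ℕ → ℕ
den n = 2 ^ (suc n !)

2≤den : ∀ n → 2 ≤ den n
2≤den n = ℕₚ.^-monoʳ-≤ 2 (ℕₚ.1≤n! (suc n))

den≢0 : ∀ n → NonZero (den n)
den≢0 n = ℕₚ.m^n≢0 2 (suc n !)

0<recip-den : ∀ n → 0ℚ ℚ.< recip (den n)
0<recip-den n = 0<recip (den n) {{den≢0 n}}

0<recip-pred-den : ∀ n → 0ℚ ℚ.< recip (pred (den n))
0<recip-pred-den n = 0<recip (pred (den n)) {{>-nonZero (ℕₚ.<⇒≤pred (2≤den n))}}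

-- This is (n+2)! = (n+2)·(n+1)! in the exponent. The growing power drives the Liouville property
-- and outweighs a product of n+1 entries below `den n`.
den-suc : ∀ n → den (suc n) ≡ den n ^ suc (suc n)
den-suc n = trans (cong (2 ^_) (ℕₚ.*-comm (suc (suc n)) (suc n !)))
  (sym (ℕₚ.^-*-assoc 2 (suc n !) (suc (suc n))))

den² : ∀ n → den n * den n ≤ den (suc n)
den² n = subst (den n * den n ≤_) (sym (den-suc n))
  (ℕₚ.*-monoʳ-≤ (den n) (ℕₚ.m≤m*n (den n) (den n ^ n) {{ℕₚ.m^n≢0 (den n) n {{den≢0 n}}}}))

den-<-suc : ∀ n → den n < den (suc n)
den-<-suc n = ℕₚ.<-≤-trans (ℕₚ.m<m*n (den n) (den n) {{den≢0 n}} (2≤den n)) (den² n)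

den-mono-< : ∀ {m n} → m < n → den m < den n
den-mono-< {m} {suc n} (s≤s m≤n) with ℕₚ.m≤n⇒m<n∨m≡n m≤n
... | inj₁ m<n  = ℕₚ.<-trans (den-mono-< m<n) (den-<-suc n)
... | inj₂ refl = den-<-suc n

recip-anti-< : ∀ {m n} .{{_ : NonZero m}} → m < n → recip n ℚ.< recip m
recip-anti-< {m@(suc _)} {n} m<n = ℚₚ.≤-<-trans (recip-anti (s≤s z≤n) m<n)
  (subst (recip (suc m) ℚ.<_) (recip-split m)
    (p<p+q (recip (suc m)) (0<recip (m * suc m))))

θ-mono-≤ : ∀ {m n} → m ≤ n → θ-partial m ℚ.≤ θ-partial n
θ-mono-≤ {m} {n} m≤n =
  subst (λ l → θ-partial m ℚ.≤ θ-partial l) (ℕₚ.m∸n+n≡m m≤n) (θ-lower (n ℕ.∸ m) m)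

-- With m = a+1, the missing part of 1/a is 1/(a(a+1)), and a(a+1) < m² ≤ n.
recip+recip-pred : ∀ m n → 2 ≤ m → m * m ≤ n →
  recip m ℚ.+ recip (pred n) ℚ.≤ recip (pred m)
recip+recip-pred (suc zero)      n (s≤s ())
recip+recip-pred (suc a@(suc _)) n _ m²≤n = subst (recip (suc a) ℚ.+ recip (pred n) ℚ.≤_) (recip-split a)
  (ℚₚ.+-monoʳ-≤ (recip (suc a)) (recip-anti (s≤s z≤n)
    (ℕₚ.<⇒≤pred (ℕₚ.<-≤-trans (ℕₚ.*-monoˡ-< (suc a) (ℕₚ.n<1+n a)) m²≤n))))

-- The term 1/(M - 1) is the sum of the Sylvester-type series that starts at 1/M and continues with
-- denominators M' = M² - M + 1. The denominators of θ grow faster, so it bounds the tail.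
θ-ceiling : ℕ → ℚ
θ-ceiling n = θ-partial n ℚ.+ recip (pred (den n))

θ-ceiling-suc : ∀ n → θ-ceiling (suc n) ℚ.≤ θ-ceiling n
θ-ceiling-suc n = subst (ℚ._≤ θ-ceiling n)
  (sym (ℚₚ.+-assoc (θ-partial n) (recip (den n)) (recip (pred (den (suc n))))))
  (ℚₚ.+-monoʳ-≤ (θ-partial n) (recip+recip-pred (den n) (den (suc n)) (2≤den n) (den² n)))

θ-ceiling-anti : ∀ k n → θ-ceiling (k + n) ℚ.≤ θ-ceiling n
θ-ceiling-anti zero    n = ℚₚ.≤-refl
θ-ceiling-anti (suc k) n = ℚₚ.≤-trans (θ-ceiling-suc (k + n)) (θ-ceiling-anti k n)

-- Partial sums rise and ceilings fall, so both can be compared at the larger of the two indices.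
θ-partial<θ-ceiling : ∀ m n → θ-partial m ℚ.< θ-ceiling n
θ-partial<θ-ceiling m n with ℕₚ.≤-total m n
... | inj₁ m≤n = ℚₚ.≤-<-trans (θ-mono-≤ m≤n) (p<p+q (θ-partial n) (0<recip-pred-den n))
... | inj₂ n≤m = ℚₚ.<-≤-trans (p<p+q (θ-partial m) (0<recip-pred-den m))
  (subst (λ l → θ-ceiling l ℚ.≤ θ-ceiling n) (ℕₚ.m∸n+n≡m n≤m) (θ-ceiling-anti (m ℕ.∸ n) n))

<ᵣθ⇒<θ-partial : fromℚ r <ᵣ θ → ∃[ m ] r ℚ.< θ-partial m
<ᵣθ⇒<θ-partial {r} (ε , 0<ε , N , r+ε≤) = N , ℚₚ.<-≤-trans (p<p+q r 0<ε) (r+ε≤ N ℕₚ.≤-refl)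

-- The positive separation that `_<ᵣ_` demands is the next term of the series, present from index
-- `suc n` on.
≤θ-partial⇒<ᵣθ : ∀ n → r ℚ.≤ θ-partial n → fromℚ r <ᵣ θ
≤θ-partial⇒<ᵣθ n r≤s = recip (den n) , 0<recip-den n , suc n , λ _ n<m →
  ℚₚ.≤-trans (ℚₚ.+-monoˡ-≤ (recip (den n)) r≤s) (θ-mono-≤ n<m)

hasDen-θ-partial : ∀ n → HasDen (2 ^ (n !)) (θ-partial n)
hasDen-θ-partial zero    = hasDen-0 2
hasDen-θ-partial (suc n) = hasDen-+
  (hasDen-∣ (subst (2 ^ (n !) ∣_) (sym (ℕₚ.^-distribˡ-+-* 2 (n !) (n * n !))) (m∣m*n (2 ^ (n * n !))))
    (hasDen-θ-partial n))
  (hasDen-recip (den n) {{den≢0 n}})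

2-val-θ-partial : ∀ k n → (∀ i → i < n → den i < 2 ^ suc k) → 2-Val≥- k (θ-partial n)
2-val-θ-partial k zero    _ = 0 , hasDen-0 _
2-val-θ-partial k (suc n) h = 2-val-+ {k}
  (2-val-θ-partial k n (λ i i<n → h i (ℕₚ.m<n⇒m<1+n i<n)))
  (2-val-recip k (den n) {{den≢0 n}} (h n ℕₚ.≤-refl))

-- Denominator tuples

sumRecip-∷ʳ : ∀ (ys : Vec ℕ n) y → sumRecip (ys ∷ʳ y) ≡ sumRecip ys ℚ.+ recip y
sumRecip-∷ʳ []       y = ℚₚ.+-comm (recip y) 0ℚ
sumRecip-∷ʳ (x ∷ xs) y = trans (cong (recip x ℚ.+_) (sumRecip-∷ʳ xs y))
  (sym (ℚₚ.+-assoc (recip x) (sumRecip xs) (recip y)))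

firstTerms-∷ʳ : ∀ f n → firstTerms f (suc n) ≡ firstTerms f n ∷ʳ f n
firstTerms-∷ʳ f zero    = refl
firstTerms-∷ʳ f (suc n) = cong (f 0 ∷_) (firstTerms-∷ʳ (λ i → f (suc i)) n)

sumRecip-den : ∀ n → sumRecip (firstTerms den n) ≡ θ-partial n
sumRecip-den zero    = refl
sumRecip-den (suc n) = begin
  sumRecip (firstTerms den (suc n))               ≡⟨ cong sumRecip (firstTerms-∷ʳ den n) ⟩
  sumRecip (firstTerms den n ∷ʳ den n)            ≡⟨ sumRecip-∷ʳ (firstTerms den n) (den n) ⟩
  sumRecip (firstTerms den n) ℚ.+ recip (den n)   ≡⟨ cong (ℚ._+ recip (den n)) (sumRecip-den n) ⟩
  θ-partial (suc n)                               ∎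
  where open ≡-Reasoning

linked-firstTerms : ∀ {R : ℕ → ℕ → Set} f → (∀ i → R (f i) (f (suc i))) →
  ∀ n → Linked R (firstTerms f n)
linked-firstTerms f Rf zero          = []
linked-firstTerms f Rf (suc zero)    = [-]
linked-firstTerms f Rf (suc (suc n)) =
  Rf 0 ∷ linked-firstTerms (λ i → f (suc i)) (λ i → Rf (suc i)) (suc n)

<⇒Rel : ∀ σ {m n} → m < n → Rel σ m n
<⇒Rel weak   = ℕₚ.<⇒≤
<⇒Rel strict m<n = m<n

inE-den : ∀ σ n → InE σ (firstTerms den n)
inE-den σ n = tabulate⁺ (λ i → 2≤den (toℕ i)) , linked-firstTerms den (λ i → <⇒Rel σ (den-<-suc i)) n

-- Lets both conventions share the bound and the equality case, which are proved for weakly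
-- increasing tuples.
inE-weak : ∀ σ {b : Vec ℕ n} → InE σ b → InE weak b
inE-weak weak   b∈E       = b∈E
inE-weak strict (2≤b , l) = 2≤b , Linked.map ℕₚ.<⇒≤ l

linked-init : ∀ {R : ℕ → ℕ → Set} (ys : Vec ℕ n) {y} → Linked R (ys ∷ʳ y) → Linked R ys
linked-init []           _       = []
linked-init (_ ∷ [])     _       = [-]
linked-init (_ ∷ x ∷ xs) (r ∷ l) = r ∷ linked-init (x ∷ xs) l

all-init : ∀ {P : ℕ → Set} (ys : Vec ℕ n) {y} → All P (ys ∷ʳ y) → All P ys × P y
all-init []       (p ∷ []) = [] , p
all-init (x ∷ xs) (p ∷ ps) = p ∷ proj₁ (all-init xs ps) , proj₂ (all-init xs ps)

all≤last : ∀ (ys : Vec ℕ n) {y} → Linked _≤_ (ys ∷ʳ y) → All (_≤ y) (ys ∷ʳ y)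
all≤last []           _       = ℕₚ.≤-refl ∷ []
all≤last (_ ∷ [])     (r ∷ _) = r ∷ ℕₚ.≤-refl ∷ []
all≤last (_ ∷ x ∷ xs) (r ∷ l) with all≤last (x ∷ xs) l
... | x≤y ∷ ps = ℕₚ.≤-trans r x≤y ∷ x≤y ∷ ps

2≤⇒≢0 : 2 ≤ n → NonZero n
2≤⇒≢0 2≤n = >-nonZero (ℕₚ.<-trans (s≤s z≤n) 2≤n)

-- The denominator is the product of the entries, each of which is at most `y`.
hasDen-sumRecip : ∀ {y} (b : Vec ℕ n) → All (2 ≤_) b → All (_≤ y) b →
  ∃[ D ] 1 ≤ D × D ≤ y ^ n × HasDen D (sumRecip b)
hasDen-sumRecip []      []          []          = 1 , ℕₚ.≤-refl , ℕₚ.≤-refl , hasDen-0 1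
hasDen-sumRecip (x ∷ b) (2≤x ∷ 2≤b) (x≤y ∷ b≤y) with hasDen-sumRecip b 2≤b b≤y
... | D , 1≤D , D≤y^n , h = x * D , ℕₚ.*-mono-≤ (ℕₚ.<⇒≤ 2≤x) 1≤D , ℕₚ.*-mono-≤ x≤y D≤y^n ,
  hasDen-+ (hasDen-∣ (m∣m*n D) (hasDen-recip x {{2≤⇒≢0 2≤x}})) (hasDen-∣ (n∣m*n x) h)

2-val-sumRecip : ∀ k {y} (b : Vec ℕ n) → y < 2 ^ suc k → All (2 ≤_) b → All (_≤ y) b →
  2-Val≥- k (sumRecip b)
2-val-sumRecip k []      _   []          []          = 0 , hasDen-0 _
2-val-sumRecip k (x ∷ b) y<  (2≤x ∷ 2≤b) (x≤y ∷ b≤y) = 2-val-+ {k}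
  (2-val-recip k x {{2≤⇒≢0 2≤x}} (ℕₚ.≤-<-trans x≤y y<)) (2-val-sumRecip k b y< 2≤b b≤y)

-- Upper bound for admissible sums, and the case of equality

sumRecip-init< : ∀ (ys : Vec ℕ n) {y} → 2 ≤ y → sumRecip ys ℚ.< sumRecip (ys ∷ʳ y)
sumRecip-init< ys {y} 2≤y = subst (sumRecip ys ℚ.<_) (sym (sumRecip-∷ʳ ys y))
  (p<p+q (sumRecip ys) (0<recip y {{2≤⇒≢0 2≤y}}))

-- Induction on the length, splitting off the last entry because it is the largest. Lying below some
-- partial sum stands in for lying below θ, which keeps the argument inside ℚ.
sumRecip≤θ-partial : ∀ (b : Vec ℕ n) → InE weak b → ∀ {m} →
  sumRecip b ℚ.< θ-partial m → sumRecip b ℚ.≤ θ-partial n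
sumRecip≤θ-partial {zero}  [] _ _ = ℚₚ.≤-refl
sumRecip≤θ-partial {suc n} b b∈E b<θ with initLast b
sumRecip≤θ-partial {suc n} _ (2≤b , l) {m} b<θ | ys , y , refl = ℚₚ.≮⇒≥ λ s<b →
  let
    2≤ys , 2≤y = all-init ys 2≤b
    ys≤s : sumRecip ys ℚ.≤ θ-partial n
    ys≤s = sumRecip≤θ-partial ys (2≤ys , linked-init ys l) {m}
             (ℚₚ.<-trans (sumRecip-init< ys 2≤y) b<θ)
    -- Otherwise 1/y ≤ 1/M, and with `ys≤s` the whole sum would be at most `θ-partial (suc n)`.
    y<M : y < den n
    y<M = ℕₚ.≰⇒> λ M≤y → ℚₚ.<-irrefl refl (ℚₚ.<-≤-trans (subst (θ-partial (suc n) ℚ.<_) (sumRecip-∷ʳ ys y) s<b)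
            (ℚₚ.+-mono-≤ ys≤s (recip-anti (ℕₚ.<⇒≤ (2≤den n)) M≤y)))
    D , 1≤D , D≤y^ , h = hasDen-sumRecip (ys ∷ʳ y) 2≤b (all≤last ys l)
    DM<den : D * den n < den (suc n)
    DM<den = subst (D * den n <_) (trans (ℕₚ.*-comm _ (den n)) (sym (den-suc n)))
      (ℕₚ.*-monoˡ-< (den n) {{den≢0 n}} (ℕₚ.≤-<-trans D≤y^ (ℕₚ.^-monoˡ-< (suc n) y<M)))
    1≤DM : 1 ≤ D * den n
    1≤DM = ℕₚ.*-mono-≤ 1≤D (ℕₚ.<⇒≤ (2≤den n))
    -- Both sums have denominator `D * den n`, which is below `den (suc n)`, so their positive
    -- difference is at least 1/(`den (suc n)` - 1).
    gap : recip (pred (den (suc n))) ℚ.≤ sumRecip (ys ∷ʳ y) ℚ.- θ-partial (suc n)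
    gap = ℚₚ.≤-trans (recip-anti 1≤DM (ℕₚ.<⇒≤pred DM<den))
      (recip≤ (D * den n) {{>-nonZero 1≤DM}}
        (hasDen-- (hasDen-∣ (m∣m*n (den n)) h) (hasDen-∣ (n∣m*n D) (hasDen-θ-partial (suc n))))
        (p<q⇒0<q-p s<b))
  -- The gap lifts the sum to `θ-ceiling (suc n)`, above every partial sum, including the `m`-th.
  in ℚₚ.<-irrefl refl
       (ℚₚ.<-trans (θ-partial<θ-ceiling m (suc n)) (ℚₚ.≤-<-trans (r≤q-p⇒p+r≤q gap) b<θ))

sumRecip≡θ-partial⇒den : ∀ (b : Vec ℕ n) → InE weak b →
  sumRecip b ≡ θ-partial n → b ≡ firstTerms den n
sumRecip≡θ-partial⇒den {zero}  [] _ _ = refl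
sumRecip≡θ-partial⇒den {suc n} b b∈E b≡s with initLast b
sumRecip≡θ-partial⇒den {suc n} _ (2≤b , l) b≡s | ys , y , refl = result
  where
  2≤ys : All (2 ≤_) ys
  2≤ys = proj₁ (all-init ys 2≤b)
  2≤y : 2 ≤ y
  2≤y = proj₂ (all-init ys 2≤b)
  ys∈E : InE weak ys
  ys∈E = 2≤ys , linked-init ys l
  ys+y≡s : sumRecip ys ℚ.+ recip y ≡ θ-partial (suc n)
  ys+y≡s = trans (sym (sumRecip-∷ʳ ys y)) b≡s
  ys≤s : sumRecip ys ℚ.≤ θ-partial n
  ys≤s = sumRecip≤θ-partial ys ys∈E {suc n} (subst (sumRecip ys ℚ.<_) b≡s (sumRecip-init< ys 2≤y))
  -- A larger `y` would make the last term too small, and by `ys≤s` the first `n` terms cannot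
  -- compensate.
  y≤M : y ≤ den n
  y≤M = ℕₚ.≮⇒≥ λ M<y → ℚₚ.<-irrefl ys+y≡s (ℚₚ.+-mono-≤-< ys≤s (recip-anti-< {{den≢0 n}} M<y))
  -- One less than the exponent of M: entries below M = 2^(K+1) have reciprocals of valuation at
  -- least -K, while 1/M has valuation -(K+1).
  K : ℕ
  K = pred (suc n !)
  M≡2^ : den n ≡ 2 ^ suc K
  M≡2^ = cong (2 ^_) (sym (ℕₚ.suc-pred (suc n !) {{>-nonZero (ℕₚ.1≤n! (suc n))}}))
  y≮M : ¬ y < den n
  -- Here 1/M is recovered as the tuple's sum, s_n + 1/M, minus s_n, both of valuation at least -K.
  y≮M y<M = ¬2-val-recip-2^ K (subst (λ x → 2-Val≥- K (recip x)) M≡2^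
    (subst (2-Val≥- K) ([p+q]-p≡q (θ-partial n) (recip (den n)))
      (2-val-+ {K} (subst (2-Val≥- K) b≡s
          (2-val-sumRecip K (ys ∷ʳ y) (subst (y <_) M≡2^ y<M) 2≤b (all≤last ys l)))
        (2-val-neg {K} (2-val-θ-partial K n (λ i i<n → subst (den i <_) M≡2^ (den-mono-< i<n)))))))
  result : ys ∷ʳ y ≡ firstTerms den (suc n)
  result with ℕₚ.m≤n⇒m<n∨m≡n y≤M
  ... | inj₁ y<M  = ⊥-elim (y≮M y<M)
  ... | inj₂ refl = trans (cong (_∷ʳ den n) (sumRecip≡θ-partial⇒den ys ys∈E
          (∙-cancelʳ ℚₚ.+-0-group (recip (den n)) (sumRecip ys) (θ-partial n) ys+y≡s)))
        (sym (firstTerms-∷ʳ den n))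

-- Greedy denominators and unique maximality

isGreedy-den : ∀ σ → IsGreedy σ θ den
isGreedy-den σ i = (2≤den i , follows i , candidate) , minimal
  where
  follows : ∀ i → FollowsPrevious σ den i (den i)
  follows zero    = tt
  follows (suc i) = <⇒Rel σ (den-<-suc i)
  candidate : fromℚ (recip (den i)) <ᵣ θ -ᵣ fromℚ (sumRecip (firstTerms den i))
  -- The separation is the term following 1/`den i`, hence the partial sums from index i+2 on.
  candidate rewrite sumRecip-den i = recip (den (suc i)) , 0<recip-den (suc i) , suc (suc i) ,
    λ m i+2≤m → p+r≤q⇒r≤q-p (subst (ℚ._≤ θ-partial m)
      (ℚₚ.+-assoc (θ-partial i) (recip (den i)) (recip (den (suc i)))) (θ-mono-≤ i+2≤m))
  minimal : ∀ x → GreedyCandidate σ θ den i x → den i ≤ x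
  minimal x (2≤x , _ , cand) rewrite sumRecip-den i with cand
  -- If x < M then 1/x ≥ 1/(M - 1), so s_i + 1/x reaches `θ-ceiling i`, yet `h` keeps it below a
  -- partial sum.
  ... | ε , 0<ε , N , h = ℕₚ.≮⇒≥ λ x<M → ℚₚ.<-irrefl refl
    (ℚₚ.<-≤-trans (θ-partial<θ-ceiling N i)
      (r≤q-p⇒p+r≤q (ℚₚ.≤-trans (recip-anti (ℕₚ.<⇒≤ 2≤x) (ℕₚ.<⇒≤pred x<M))
        (ℚₚ.<⇒≤ (ℚₚ.<-≤-trans (p<p+q (recip x) 0<ε) (h N ℕₚ.≤-refl))))))

isUniqueMaximizing-den : ∀ σ n → IsUniqueMaximizing σ θ (firstTerms den n)
isUniqueMaximizing-den σ n = (inE-den σ n , attained , bound) , unique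
  where
  attained : Attainable σ n θ (sumRecip (firstTerms den n))
  attained = firstTerms den n , inE-den σ n , refl ,
    ≤θ-partial⇒<ᵣθ n (ℚₚ.≤-reflexive (sumRecip-den n))
  bound : ∀ s → Attainable σ n θ s → s ℚ.≤ sumRecip (firstTerms den n)
  bound s (b , b∈E , refl , b<θ) with <ᵣθ⇒<θ-partial {s} b<θ
  ... | m , s<θ = subst (s ℚ.≤_) (sym (sumRecip-den n))
    (sumRecip≤θ-partial b (inE-weak σ b∈E) {m} s<θ)
  unique : ∀ b → IsMaximizing σ θ b → b ≡ firstTerms den n
  unique b (b∈E , att , max) = sumRecip≡θ-partial⇒den b (inE-weak σ b∈E)
    -- The sums of two maximizing tuples bound each other, so `b` falls under the equality case.
    (trans (ℚₚ.≤-antisym (bound _ att) (max _ attained)) (sumRecip-den n))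

-- Diophantine approximation of θ

θ-partial-gap : ∀ {m n} → m ≤ n → ℚ.∣ θ-partial n ℚ.- θ-partial m ∣ ≡ θ-partial n ℚ.- θ-partial m
θ-partial-gap {m} {n} m≤n = ℚₚ.0≤p⇒∣p∣≡p (p+r≤q⇒r≤q-p
  (subst (ℚ._≤ θ-partial n) (sym (ℚₚ.+-identityʳ (θ-partial m))) (θ-mono-≤ m≤n)))

-- With Q = `den m`, a denominator of s_{m+1}, the tail is at most 1/(Q^(m+2) - 1), far below 1/Q^m.
θ-partial-approximates : ∀ m → let d = ∣ θ -ᵣ fromℚ (θ-partial (suc m)) ∣ᵣ in
  (fromℚ 0ℚ <ᵣ d) × (d <ᵣ fromℚ (recip (den m ^ m)))
θ-partial-approximates m = lower , upper
  where
  s : ℚ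
  s = θ-partial (suc m)
  Q^m : ℕ
  Q^m = den m ^ m
  instance
    Q^m≢0 : NonZero Q^m
    Q^m≢0 = ℕₚ.m^n≢0 (den m) m {{den≢0 m}}
    2Q^m≢0 : NonZero (2 * Q^m)
    2Q^m≢0 = ℕₚ.m*n≢0 2 Q^m
  lower : fromℚ 0ℚ <ᵣ ∣ θ -ᵣ fromℚ s ∣ᵣ
  lower = recip (den (suc m)) , 0<recip-den (suc m) , suc (suc m) , λ n m+2≤n →
    subst₂ ℚ._≤_ (sym (ℚₚ.+-identityˡ _)) (sym (θ-partial-gap (ℕₚ.<⇒≤ m+2≤n)))
      (p+r≤q⇒r≤q-p (θ-mono-≤ m+2≤n))
  -- The factor 2 keeps the distance within half of 1/Q^m; the other half is the separation in
  -- `upper`. It is affordable since 4Q^m ≤ Q^(m+2).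
  2Q^m<den : 2 * Q^m < den (suc m)
  2Q^m<den = ℕₚ.<-≤-trans 
    (subst (2 * Q^m <_) (ℕₚ.*-comm (2 * Q^m) 2) (ℕₚ.m<m*n (2 * Q^m) 2 ℕₚ.≤-refl))
    (subst (2 * (2 * Q^m) ≤_) (sym (den-suc m))
      (ℕₚ.*-mono-≤ (2≤den m) (ℕₚ.*-monoˡ-≤ Q^m (2≤den m))))
  halves : ∀ k .{{_ : NonZero k}} → recip (2 * k) ℚ.+ recip (2 * k) ≡ recip k
  halves (suc k) = recip-double k
  upper : ∣ θ -ᵣ fromℚ s ∣ᵣ <ᵣ fromℚ (recip Q^m)
  upper = recip (2 * Q^m) , 0<recip (2 * Q^m) , suc m , λ n m<n →
    subst₂ ℚ._≤_ (cong (ℚ._+ recip (2 * Q^m)) (sym (θ-partial-gap m<n))) (halves Q^m)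
      (ℚₚ.+-monoˡ-≤ (recip (2 * Q^m))
        (ℚₚ.≤-trans
          (subst (θ-partial n ℚ.- s ℚ.≤_) ([p+q]-p≡q s (recip (pred (den (suc m)))))
            (ℚₚ.+-monoˡ-≤ (ℚ.- s) (ℚₚ.<⇒≤ (θ-partial<θ-ceiling n (suc m)))))
          (recip-anti (>-nonZero⁻¹ (2 * Q^m)) (ℕₚ.<⇒≤pred 2Q^m<den))))

liouville-θ : Liouville θ
liouville-θ m _ with hasDen-/ (den m) {{den≢0 m}} (hasDen-θ-partial (suc m))
... | P , s≡P/Q = P , den m , 2≤den m ,
  subst (λ x → let d = ∣ θ -ᵣ fromℚ x ∣ᵣ in (fromℚ 0ℚ <ᵣ d) × (d <ᵣ fromℚ (recip (den m ^ m))))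
    s≡P/Q (θ-partial-approximates m)

-- If θ were q with denominator d₀, then q - s_{n₀} would be a positive fraction over d₀Q, yet at
-- most 1/(`den n₀` - 1), which is smaller than 1/(d₀Q). Taking n₀ = d₀ + 1 makes Q = `den d₀`
-- exceed d₀ + 1.
irrational-θ : Irrational θ
irrational-θ q θ≃q = ℚₚ.<-irrefl refl (ℚₚ.<-≤-trans (recip-anti-< {{dQ≢0}} dQ<pred)
    (ℚₚ.≤-trans (recip≤ (d₀ * Q) {{dQ≢0}} hasDen-q-s (p<q⇒0<q-p s<q)) q-s≤))
  where
  d₀ n₀ Q : ℕ
  d₀ = ℚ.↧ₙ q
  n₀ = suc d₀
  Q  = den d₀
  dQ≢0 : NonZero (d₀ * Q)
  dQ≢0 = ℕₚ.m*n≢0 d₀ Q {{_}} {{den≢0 d₀}}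
  s<q : θ-partial n₀ ℚ.< q
  -- If q were at most s_{n₀}, all later partial sums would exceed it by the next term or more.
  s<q = ℚₚ.≰⇒> λ q≤s → let N , h = θ≃q (recip (den n₀)) (0<recip-den n₀)
                           m = N ℕ.⊔ suc n₀ in
    ℚₚ.<-irrefl refl (ℚₚ.≤-<-trans
      (p+r≤q⇒r≤q-p (ℚₚ.≤-trans (ℚₚ.+-monoˡ-≤ (recip (den n₀)) q≤s) (θ-mono-≤ (ℕₚ.m≤n⊔m N (suc n₀)))))
      (ℚₚ.≤-<-trans (p≤∣p∣ _) (h m (ℕₚ.m≤m⊔n N (suc n₀)))))
  q≤ceiling : q ℚ.≤ θ-ceiling n₀
  -- A q above the ceiling would stay farther than q minus the ceiling from every partial sum.
  q≤ceiling = ℚₚ.≮⇒≥ λ c<q → let N , h = θ≃q (q ℚ.- θ-ceiling n₀) (p<q⇒0<q-p c<q) in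
    ℚₚ.<-irrefl refl (ℚₚ.<-trans (h N ℕₚ.≤-refl)
      (ℚₚ.<-≤-trans (ℚₚ.+-monoʳ-< q (ℚₚ.neg-antimono-< (θ-partial<θ-ceiling N n₀)))
        (subst (q ℚ.- θ-partial N ℚ.≤_) (ℚ-Lemmas.∣p-q∣≡∣q-p∣ q (θ-partial N)) (p≤∣p∣ _))))
  q-s≤ : q ℚ.- θ-partial n₀ ℚ.≤ recip (pred (den n₀))
  q-s≤ = subst (q ℚ.- θ-partial n₀ ℚ.≤_) ([p+q]-p≡q (θ-partial n₀) (recip (pred (den n₀))))
    (ℚₚ.+-monoˡ-≤ (ℚ.- θ-partial n₀) q≤ceiling)
  hasDen-q-s : HasDen (d₀ * Q) (q ℚ.- θ-partial n₀)
  hasDen-q-s = hasDen-- (hasDen-∣ (m∣m*n Q) (hasDen-↧ q)) (hasDen-∣ (n∣m*n d₀) (hasDen-θ-partial n₀))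
  dQ<pred : d₀ * Q < pred (den n₀)
  dQ<pred = ℕₚ.<⇒≤pred (begin-strict
    suc (d₀ * Q)   ≤⟨ ℕₚ.+-monoˡ-≤ (d₀ * Q) (ℕₚ.<⇒≤ (2≤den d₀)) ⟩
    suc d₀ * Q     <⟨ ℕₚ.*-monoˡ-< Q {{den≢0 d₀}} d₀+1<Q ⟩
    Q * Q          ≤⟨ den² d₀ ⟩
    den n₀         ∎)
    where
    open ℕₚ.≤-Reasoning
    d₀+1<Q : suc d₀ < Q
    d₀+1<Q = ℕₚ.<-≤-trans (n<2^n (suc d₀)) (ℕₚ.^-monoʳ-≤ 2 (n≤n! (suc d₀)))

mainTheorem2 : Liouville θ ×
    Irrational θ ×
    (∀ (σ : Convention) →
    Σ[ g ∈ (ℕ → ℕ) ]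
    (IsGreedy σ θ g ×
    (∀ (n : ℕ) → 1 ≤ n → IsUniqueMaximizing σ θ (firstTerms g n))))
mainTheorem2 = liouville-θ , irrational-θ , λ σ →
  den , isGreedy-den σ , λ n _ → isUniqueMaximizing-den σ n
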